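{- For every positive integer $k$, the graph of a $\{1,2k\}$-leaper on a $(4k+1)\times(4k+2)$ board is Hamiltonian (has a cycle through every vertex exactly once).
   Context: For positive integers $r,s$, the graph of an $\{r,s\}$-leaper on an $m\times n$ board has vertex set $\{(x,y): 0\le x<m,\ 0\le y<n\}$ (integers), with an edge between $(x,y)$ and $(x',y')$ whenever $(x'-x,y'-y)\in\{(\pm r,\pm s),(\pm s,\pm r)\}$. -}

module Defs where

open import Data.Nat using (ℕ; suc; _*_; _+_; _≤_; _%_)
open import Data.Nat.DivMod using (m%n<n)
open import Data.Integer using (ℤ; +_; -_; _-_)
open import Data.Fin using (Fin; toℕ; fromℕ<)
open import Data.Product using (_×_; _,_; Σ-syntax)
open import Data.Sum using (_⊎_)
open import Relation.Binary.PropositionalEquality using (_≡_)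
open import Function.Bundles using (_⤖_; Bijection)

Square : ℕ → ℕ → Set
Square m n = Fin m × Fin n

δ : {k : ℕ} → Fin k → Fin k → ℤ
δ a a' = + toℕ a' - + toℕ a

LeaperMove : ℕ → ℕ → ℤ → ℤ → Set
LeaperMove r s d e =
  ((d ≡ + r ⊎ d ≡ - (+ r)) × (e ≡ + s ⊎ e ≡ - (+ s)))
  ⊎ ((d ≡ + s ⊎ d ≡ - (+ s)) × (e ≡ + r ⊎ e ≡ - (+ r)))

LeaperAdj : (r s m n : ℕ) → Square m n → Square m n → Set
LeaperAdj r s m n (x , y) (x' , y') = LeaperMove r s (δ x x') (δ y y')

next : {N : ℕ} → Fin N → Fin N
next {suc N} i = fromℕ< (m%n<n (suc (toℕ i)) (suc N))

-- A graph with vertex type V (|V| = N) and adjacency E is Hamiltonian if there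
-- is a cycle visiting every vertex exactly once: a bijection c : Fin N → V
-- (the cyclic ordering of the vertices) with c i adjacent to c (i+1 mod N),
-- and N ≥ 3 so that this is a genuine cycle.
Hamiltonian : (N : ℕ) (V : Set) → (V → V → Set) → Set
Hamiltonian N V E =
  3 ≤ N × Σ[ c ∈ Fin N ⤖ V ] (∀ i → E (Bijection.to c i) (Bijection.to c (next i)))

LeaperHamiltonian : (r s m n : ℕ) → Set
LeaperHamiltonian r s m n = Hamiltonian (m * n) (Square m n) (LeaperAdj r s m n)

{-# OPTIONS --safe #-}
module Submission where

open import Defs
open import Data.Nat using (ℕ; zero; suc; _*_; _+_; _∸_; _≤_; _<_; z≤n; s≤s; s≤s⁻¹; z<s; _≤?_; >-nonZero)
open import Data.Nat.Properties
open import Data.Nat.DivMod using (m<n⇒m%n≡m; n%n≡0)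
open import Data.Nat.Tactic.RingSolver using (solve-∀)
import Data.Integer as ℤ
import Data.Integer.Properties as ℤ
open import Data.Fin using (Fin; toℕ; fromℕ<; punchOut; remQuot; combine)
import Data.Fin.Properties as Fin
open import Data.List using (List; []; _∷_; _++_; length; map; reverse)
open import Data.List.Properties using (unfold-reverse; length-reverse; length-++; length-map)
open import Data.List.Relation.Unary.Any using (here; there)
open import Data.List.Relation.Unary.Any.Properties using (reverse⁺)
open import Data.List.Membership.Propositional using (_∈_)
open import Data.List.Membership.Propositional.Properties using (∈-++⁺ˡ; ∈-++⁺ʳ; ∈-map⁺)
open import Data.Product using (_×_; _,_; ∃; proj₁; proj₂; uncurry)
open import Data.Product.Properties using (,-injectiveˡ; ,-injectiveʳ)
open import Data.Sum using (_⊎_; inj₁; inj₂)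
open import Function using (_∘_)
open import Function.Bundles using (mk⤖)
open import Function.Consequences.Propositional using (strictlySurjective⇒surjective)
open import Function.Definitions using (Injective)
open import Relation.Binary.Definitions using (tri<; tri≈; tri>)
open import Relation.Nullary using (yes; no; contradiction)
open import Relation.Binary.PropositionalEquality

-- Write s = 2k. The reflection y ↦ 2s + 1 − y maps the graph to itself, so it suffices to find a
-- path that meets each orbit of squares once and whose end is adjacent to the mirror image of
-- its start: the path followed by its mirror image is then a Hamiltonian cycle. For k ≥ 2 such a
-- path is a spiral of crossings from one side of the board to the other, each of them a zigzag
-- through two neighbouring rows of orbits. Crossings are joined through the middle column; the
-- spiral winds four rows at a time around a turn through the innermost orbits, and ends along
-- the rim.

-- Closed walks and counting on finite sets.

next-cases : ∀ {N} (i : Fin N) →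
  (suc (toℕ i) < N × toℕ (next i) ≡ suc (toℕ i)) ⊎ (suc (toℕ i) ≡ N × toℕ (next i) ≡ 0)
next-cases {suc N} i with m≤n⇒m<n∨m≡n (Fin.toℕ<n i)
... | inj₁ i+1<N = inj₁ (i+1<N , trans (Fin.toℕ-fromℕ< _) (m<n⇒m%n≡m i+1<N))
... | inj₂ i+1≡N = inj₂ (i+1≡N , trans (Fin.toℕ-fromℕ< _)
                                   (trans (cong (Data.Nat._% suc N) i+1≡N) (n%n≡0 (suc N))))

-- Pigeonhole: if `j` were missed, deleting it from the codomain would leave an injection of
-- `Fin (suc n)` into `Fin n`.
injective⇒surjective : ∀ {n} {f : Fin n → Fin n} → Injective _≡_ _≡_ f → ∀ j → ∃ λ i → f i ≡ j
injective⇒surjective {zero} _ ()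
injective⇒surjective {suc n} {f} inj j with Fin.any? (λ i → f i Fin.≟ j)
... | yes found = found
... | no missed = contradiction (Fin.injective⇒≤ {f = squeeze} squeeze-injective) 1+n≰n
  where
  missed′ : ∀ i → j ≢ f i
  missed′ i j≡fi = missed (i , sym j≡fi)
  squeeze : Fin (suc n) → Fin n
  squeeze i = punchOut (missed′ i)
  squeeze-injective : Injective _≡_ _≡_ squeeze
  squeeze-injective {x} {y} eq = inj (Fin.punchOut-injective (missed′ x) (missed′ y) eq)

-- The walk pos may a priori leave the image of φ; since it has as many steps as there are
-- squares and meets all of them, it does not.
closedWalk⇒hamiltonian : ∀ {m n} {A : Set} {R : A → A → Set} {E : Square m n → Square m n → Set}
  (φ : Square m n → A) → Injective _≡_ _≡_ φ → (∀ v w → R (φ v) (φ w) → E v w) →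
  (pos : Fin (m * n) → A) → (∀ i → R (pos i) (pos (next i))) → (∀ v → ∃ λ i → pos i ≡ φ v) →
  3 ≤ m * n → Hamiltonian (m * n) (Square m n) E
closedWalk⇒hamiltonian {m} {n} {A} {R} {E} φ φ-injective reflects pos steps meets N≥3 =
  N≥3 , mk⤖ (to-injective , strictlySurjective⇒surjective to-surjective) , edges
  where
  index : Square m n → Fin (m * n)
  index v = proj₁ (meets v)
  pos-index : ∀ v → pos (index v) ≡ φ v
  pos-index v = proj₂ (meets v)
  index-injective : Injective _≡_ _≡_ index
  index-injective {v} {w} eq = φ-injective (trans (sym (pos-index v)) (trans (cong pos eq) (pos-index w)))
  remQuot-injective : Injective _≡_ _≡_ (remQuot {m} n)
  remQuot-injective {i} {j} eq =
    trans (sym (Fin.combine-remQuot {m} n i)) (trans (cong (uncurry combine) eq) (Fin.combine-remQuot {m} n j))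
  -- Through `remQuot`, `index` becomes an injective self-map of a finite set, hence onto: every
  -- position of the walk is the chosen position of some square.
  preimage : ∀ i → ∃ λ j → index (remQuot {m} n j) ≡ i
  preimage = injective⇒surjective (remQuot-injective ∘ index-injective)
  to : Fin (m * n) → Square m n
  to i = remQuot n (proj₁ (preimage i))
  index-to : ∀ i → index (to i) ≡ i
  index-to i = proj₂ (preimage i)
  to-injective : Injective _≡_ _≡_ to
  to-injective {i} {j} eq = trans (sym (index-to i)) (trans (cong index eq) (index-to j))
  to-surjective : ∀ v → ∃ λ i → to i ≡ v
  to-surjective v = index v , index-injective (index-to (index v))
  pos≡φ : ∀ i → pos i ≡ φ (to i)
  pos≡φ i = trans (cong pos (sym (index-to i))) (pos-index (to i))
  edges : ∀ i → E (to i) (to (next i))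
  edges i = reflects (to i) (to (next i)) (subst₂ R (pos≡φ i) (pos≡φ (next i)) (steps i))

-- Parity, and coordinates on the board.

halve : ∀ n → ∃ λ m → n ≡ m * 2 ⊎ n ≡ 1 + m * 2
halve zero    = 0 , inj₁ refl
halve (suc n) with halve n
... | m , inj₁ refl = m , inj₂ refl
... | m , inj₂ refl = suc m , inj₁ refl

-- With s = 2k, the columns left of the middle one are x = 2m (le m) and x = 2m + 1 (lo m), those
-- right of it x = s + 1 + 2m (ro m) and x = s + 2 + 2m (re m); only the moves (±1, ±s) inside
-- these pairs of columns are used.
data Column : Set where
  le lo ro re : ℕ → Column
  mid         : Column

-- Rows are counted from the horizontal axis of symmetry: (up , η) is y = s + 1 + η and
-- (down , η) is y = s − η.
data Side : Set where
  up down : Side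

opposite : Side → Side
opposite up   = down
opposite down = up

opposite-involutive : ∀ σ → opposite (opposite σ) ≡ σ
opposite-involutive up   = refl
opposite-involutive down = refl

Row : Set
Row = Side × ℕ

Vertex : Set
Vertex = Column × Row

mirrorᵣ : Row → Row
mirrorᵣ (σ , η) = opposite σ , η

mirror : Vertex → Vertex
mirror (c , r) = c , mirrorᵣ r

mirror-involutive : ∀ v → mirror (mirror v) ≡ v
mirror-involutive (c , σ , η) = cong (λ τ → c , τ , η) (opposite-involutive σ)

-- Membership by position, so that a vertex of an explicit block can be cited by its place in it.
pattern #0 = here refl
pattern #1 = there #0
pattern #2 = there #1
pattern #3 = there #2
pattern #4 = there #3
pattern #5 = there #4
pattern #6 = there #5
pattern #7 = there #6
pattern #8 = there #7
pattern #9 = there #8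
pattern #10 = there #9
pattern #11 = there #10
pattern #12 = there #11
pattern #13 = there #12
pattern #14 = there #13

-- The leaper graph in these coordinates.

module Leaper (k s : ℕ) where

  data Beside : Column → Column → Set where
    le-lo : ∀ {m} → Beside (le m) (lo m)
    lo-le : ∀ {m} → Beside (lo m) (le m)
    ro-re : ∀ {m} → Beside (ro m) (re m)
    re-ro : ∀ {m} → Beside (re m) (ro m)

  -- Even columns are matched with a slip: `le (suc m)`, not `le m`, lies at distance `s` from
  -- `re m`. This carries a zigzag from one pair to the next. The extreme columns x = 0 and x = 2s
  -- are left over and meet the middle one.
  data Across : Column → Column → Set where
    le-mid : Across (le 0) mid
    mid-le : Across mid (le 0)
    mid-re : ∀ {m} → suc m ≡ k → Across mid (re m)
    re-mid : ∀ {m} → suc m ≡ k → Across (re m) mid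
    le-re  : ∀ {m} → Across (le (suc m)) (re m)
    re-le  : ∀ {m} → Across (re m) (le (suc m))
    lo-ro  : ∀ {m} → Across (lo m) (ro m)
    ro-lo  : ∀ {m} → Across (ro m) (lo m)

  data Next : Row → Row → Set where
    inc  : ∀ {σ η} → Next (σ , η) (σ , suc η)
    dec  : ∀ {σ η} → Next (σ , suc η) (σ , η)
    over : ∀ {σ} → Next (σ , 0) (opposite σ , 0)

  -- Rows s + 1 + η and s - η′ differ by 1 + η + η′, whence the equation in `cross`. On one side η
  -- runs only from 0 to `s`, so a jump by `s` within it joins the two extreme rows.
  data Shift : Row → Row → Set where
    cross : ∀ {σ η η′} → suc (η + η′) ≡ s → Shift (σ , η) (opposite σ , η′)
    out   : ∀ {σ} → Shift (σ , 0) (σ , s)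
    back  : ∀ {σ} → Shift (σ , s) (σ , 0)

  data Adj : Vertex → Vertex → Set where
    hor : ∀ {c c′ r r′} → Beside c c′ → Shift r r′ → Adj (c , r) (c′ , r′)
    ver : ∀ {c c′ r r′} → Across c c′ → Next r r′ → Adj (c , r) (c′ , r′)

  Beside-sym : ∀ {c c′} → Beside c c′ → Beside c′ c
  Beside-sym le-lo = lo-le
  Beside-sym lo-le = le-lo
  Beside-sym ro-re = re-ro
  Beside-sym re-ro = ro-re

  Across-sym : ∀ {c c′} → Across c c′ → Across c′ c
  Across-sym le-mid     = mid-le
  Across-sym mid-le     = le-mid
  Across-sym (mid-re e) = re-mid e
  Across-sym (re-mid e) = mid-re e
  Across-sym le-re      = re-le
  Across-sym re-le      = le-re
  Across-sym lo-ro      = ro-lo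
  Across-sym ro-lo      = lo-ro

  Next-sym : ∀ {r r′} → Next r r′ → Next r′ r
  Next-sym inc           = dec
  Next-sym dec           = inc
  Next-sym (over {up})   = over
  Next-sym (over {down}) = over

  Shift-sym : ∀ {r r′} → Shift r r′ → Shift r′ r
  Shift-sym (cross {up}   {η} {η′} e) = cross (trans (cong suc (+-comm η′ η)) e)
  Shift-sym (cross {down} {η} {η′} e) = cross (trans (cong suc (+-comm η′ η)) e)
  Shift-sym out  = back
  Shift-sym back = out

  Adj-sym : ∀ {u v} → Adj u v → Adj v u
  Adj-sym (hor b h) = hor (Beside-sym b) (Shift-sym h)
  Adj-sym (ver a n) = ver (Across-sym a) (Next-sym n)

  Next-mirror : ∀ {r r′} → Next r r′ → Next (mirrorᵣ r) (mirrorᵣ r′)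
  Next-mirror inc  = inc
  Next-mirror dec  = dec
  Next-mirror over = over

  Shift-mirror : ∀ {r r′} → Shift r r′ → Shift (mirrorᵣ r) (mirrorᵣ r′)
  Shift-mirror (cross e) = cross e
  Shift-mirror out       = out
  Shift-mirror back      = back

  Adj-mirror : ∀ {u v} → Adj u v → Adj (mirror u) (mirror v)
  Adj-mirror (hor b h) = hor b (Shift-mirror h)
  Adj-mirror (ver a n) = ver a (Next-mirror n)

  -- Paths, and the orbits they visit.

  infixr 5 _∷⟨_⟩_ _++⟨_⟩_

  data Path : Vertex → Vertex → Set where
    [_]     : ∀ v → Path v v
    _∷⟨_⟩_ : ∀ u {v w} → Adj u v → Path v w → Path u w

  private variable
    u v w x : Vertex
    c : Column
    η : ℕ

  vertices : Path u v → List Vertex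
  vertices [ v ]          = v ∷ []
  vertices (u ∷⟨ _ ⟩ p) = u ∷ vertices p

  ∣_∣ : Path u v → ℕ
  ∣ p ∣ = length (vertices p)

  _++⟨_⟩_ : Path u v → Adj v w → Path w x → Path u x
  [ v ]          ++⟨ e ⟩ q = v ∷⟨ e ⟩ q
  (u ∷⟨ f ⟩ p) ++⟨ e ⟩ q = u ∷⟨ f ⟩ (p ++⟨ e ⟩ q)

  reversePath : Path u v → Path v u
  reversePath [ v ]          = [ v ]
  reversePath (u ∷⟨ e ⟩ p) = reversePath p ++⟨ Adj-sym e ⟩ [ u ]

  mirrorPath : Path u v → Path (mirror u) (mirror v)
  mirrorPath [ v ]          = [ mirror v ]
  mirrorPath (u ∷⟨ e ⟩ p) = mirror u ∷⟨ Adj-mirror e ⟩ mirrorPath p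

  vertices-++ : (p : Path u v) {e : Adj v w} (q : Path w x) →
                vertices (p ++⟨ e ⟩ q) ≡ vertices p ++ vertices q
  vertices-++ [ v ]          q = refl
  vertices-++ (u ∷⟨ f ⟩ p) q = cong (u ∷_) (vertices-++ p q)

  vertices-reverse : (p : Path u v) → vertices (reversePath p) ≡ reverse (vertices p)
  vertices-reverse [ v ]          = refl
  vertices-reverse (u ∷⟨ e ⟩ p) =
    trans (vertices-++ (reversePath p) [ u ])
      (trans (cong (_++ u ∷ []) (vertices-reverse p)) (sym (unfold-reverse u (vertices p))))

  vertices-mirror : (p : Path u v) → vertices (mirrorPath p) ≡ map mirror (vertices p)
  vertices-mirror [ v ]          = refl
  vertices-mirror (u ∷⟨ e ⟩ p) = cong (mirror u ∷_) (vertices-mirror p)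

  ∣++∣ : (p : Path u v) {e : Adj v w} (q : Path w x) → ∣ p ++⟨ e ⟩ q ∣ ≡ ∣ p ∣ + ∣ q ∣
  ∣++∣ p q = trans (cong length (vertices-++ p q)) (length-++ (vertices p))

  ∣reverse∣ : (p : Path u v) → ∣ reversePath p ∣ ≡ ∣ p ∣
  ∣reverse∣ p = trans (cong length (vertices-reverse p)) (length-reverse (vertices p))

  ∣mirror∣ : (p : Path u v) → ∣ mirrorPath p ∣ ≡ ∣ p ∣
  ∣mirror∣ p = trans (cong length (vertices-mirror p)) (length-map mirror (vertices p))

  -- The side is existential: what counts is the orbit under `mirror`. Pieces may therefore be
  -- mirrored or reversed freely without changing what they cover.
  data Visits (p : Path u v) (c : Column) (η : ℕ) : Set where
    visit : ∀ σ → (c , σ , η) ∈ vertices p → Visits p c η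

  infix 4 _⊒_
  _⊒_ : Path u v → Path w x → Set
  p ⊒ q = ∀ {c η} → Visits q c η → Visits p c η

  ⊒-++ˡ : (p : Path u v) {e : Adj v w} (q : Path w x) → p ++⟨ e ⟩ q ⊒ p
  ⊒-++ˡ p q (visit σ ∈p) = visit σ (subst (_ ∈_) (sym (vertices-++ p q)) (∈-++⁺ˡ ∈p))

  ⊒-++ʳ : (p : Path u v) {e : Adj v w} (q : Path w x) → p ++⟨ e ⟩ q ⊒ q
  ⊒-++ʳ p q (visit σ ∈q) = visit σ (subst (_ ∈_) (sym (vertices-++ p q)) (∈-++⁺ʳ (vertices p) ∈q))

  ⊒-∷ : {e : Adj u v} (p : Path v w) → u ∷⟨ e ⟩ p ⊒ p
  ⊒-∷ p (visit σ ∈p) = visit σ (there ∈p)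

  ⊒-reverse : (p : Path u v) → reversePath p ⊒ p
  ⊒-reverse p (visit σ ∈p) = visit σ (subst (_ ∈_) (sym (vertices-reverse p)) (reverse⁺ ∈p))

  ⊒-mirror : (p : Path u v) → mirrorPath p ⊒ p
  ⊒-mirror p (visit σ ∈p) = visit (opposite σ) (subst (_ ∈_) (sym (vertices-mirror p)) (∈-map⁺ mirror ∈p))

  visits-start : (p : Path (c , up , η) v) → Visits p c η
  visits-start [ _ ]          = visit up #0
  visits-start (_ ∷⟨ _ ⟩ _) = visit up #0

  module _ {from to : ℕ → Vertex} (block : ∀ m → Path (from m) (to m))
           (link : ∀ m → Adj (to m) (from (suc m))) where

    chain : ∀ n → Path (from 0) (to n)
    chain zero    = block 0
    chain (suc n) = chain n ++⟨ link n ⟩ block (suc n)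

    chain-⊒ : ∀ {m n} → m ≤ n → chain n ⊒ block m
    chain-⊒ {n = zero} z≤n = λ v → v
    chain-⊒ {m} {suc n} m≤1+n with m≤n⇒m<n∨m≡n m≤1+n
    ... | inj₁ (s≤s m≤n) = ⊒-++ˡ (chain n) (block (suc n)) ∘ chain-⊒ m≤n
    ... | inj₂ refl      = ⊒-++ʳ (chain n) (block (suc n))

    ∣chain∣ : ∀ {ℓ} → (∀ m → ∣ block m ∣ ≡ ℓ) → ∀ n → ∣ chain n ∣ ≡ suc n * ℓ
    ∣chain∣ {ℓ} eq zero    = trans (eq 0) (sym (+-identityʳ ℓ))
    ∣chain∣ {ℓ} eq (suc n) = trans (∣++∣ (chain n) (block (suc n)))
      (trans (cong₂ _+_ (∣chain∣ eq n) (eq (suc n))) (+-comm (suc n * ℓ) ℓ))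

  -- Past the end the value is the last vertex; the tour is only read at positions below its length.
  at : Path u v → ℕ → Vertex
  at [ v ]          _       = v
  at (u ∷⟨ _ ⟩ p) zero    = u
  at (u ∷⟨ _ ⟩ p) (suc i) = at p i

  at-zero : (p : Path u v) → at p 0 ≡ u
  at-zero [ _ ]          = refl
  at-zero (_ ∷⟨ _ ⟩ _) = refl

  at-step : (p : Path u v) → ∀ i → suc i < ∣ p ∣ → Adj (at p i) (at p (suc i))
  at-step [ _ ]          i       (s≤s ())
  at-step (u ∷⟨ e ⟩ p) zero    _         = subst (Adj u) (sym (at-zero p)) e
  at-step (u ∷⟨ e ⟩ p) (suc i) (s≤s i<)  = at-step p i i<

  at-last : (p : Path u v) → ∀ i → suc i ≡ ∣ p ∣ → at p i ≡ v
  at-last [ _ ]                            _       _  = refl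
  at-last (_ ∷⟨ _ ⟩ p@([ _ ]))          (suc i) eq = at-last p i (suc-injective eq)
  at-last (_ ∷⟨ _ ⟩ p@(_ ∷⟨ _ ⟩ _)) (suc i) eq = at-last p i (suc-injective eq)

  ∈⇒at : (p : Path u v) → x ∈ vertices p → ∃ λ i → i < ∣ p ∣ × at p i ≡ x
  ∈⇒at [ _ ]          (here refl) = 0 , z<s , refl
  ∈⇒at (_ ∷⟨ _ ⟩ _) (here refl) = 0 , z<s , refl
  ∈⇒at (_ ∷⟨ _ ⟩ p) (there x∈p) with ∈⇒at p x∈p
  ... | i , i< , eq = suc i , s≤s i< , eq

  -- Half tours, and the passage from coordinates to squares.

  data OnBoard : Column → Set where
    le  : ∀ {m} → m < k → OnBoard (le m)
    lo  : ∀ {m} → m < k → OnBoard (lo m)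
    ro  : ∀ {m} → m < k → OnBoard (ro m)
    re  : ∀ {m} → m < k → OnBoard (re m)
    mid : OnBoard mid

  -- The size is the number of orbits, half the number of squares. Together with `visitsAll` it
  -- forces each orbit to be met exactly once.
  record HalfTour : Set where
    field
      {start end} : Vertex
      path        : Path start end
      closes      : Adj end (mirror start)
      size        : ∣ path ∣ ≡ (4 * k + 1) * (2 * k + 1)
      visitsAll   : ∀ {c η} → OnBoard c → η ≤ s → Visits path c η

  column : Column → ℕ
  column (le m) = m * 2
  column (lo m) = 1 + m * 2
  column mid    = s
  column (ro m) = 1 + (s + m * 2)
  column (re m) = 2 + (s + m * 2)

  -- The lower half, y = s - η, is written as a sum to avoid truncated subtraction.
  InRow : Row → ℕ → Set
  InRow (up   , η) y = y ≡ suc s + η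
  InRow (down , η) y = η + y ≡ s

  InRow-unique : ∀ {r y y′} → InRow r y → InRow r y′ → y ≡ y′
  InRow-unique {up , _}   ρ ρ′ = trans ρ (sym ρ′)
  InRow-unique {down , η} ρ ρ′ = +-cancelˡ-≡ η _ _ (trans ρ (sym ρ′))

  Apart : ℕ → ℕ → ℕ → Set
  Apart t a b = b ≡ t + a ⊎ a ≡ t + b

  Beside⇒Apart : ∀ {c c′} → Beside c c′ → Apart 1 (column c) (column c′)
  Beside⇒Apart le-lo = inj₁ refl
  Beside⇒Apart lo-le = inj₂ refl
  Beside⇒Apart ro-re = inj₁ refl
  Beside⇒Apart re-ro = inj₂ refl

  re≡s+ : ∀ m → column (re m) ≡ s + suc m * 2
  re≡s+ m = sym (trans (+-suc s _) (cong suc (+-suc s _)))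

  Across⇒Apart : s ≡ 2 * k → ∀ {c c′} → Across c c′ → Apart s (column c) (column c′)
  Across⇒Apart s≡2k = λ where
      le-mid            → inj₁ (sym (+-identityʳ s))
      mid-le            → inj₂ (sym (+-identityʳ s))
      (mid-re {m} refl) → inj₁ (last m s≡2k)
      (re-mid {m} refl) → inj₂ (last m s≡2k)
      (le-re {m})       → inj₁ (re≡s+ m)
      (re-le {m})       → inj₂ (re≡s+ m)
      (lo-ro {m})       → inj₁ (sym (+-suc s _))
      (ro-lo {m})       → inj₂ (sym (+-suc s _))
    where
    -- The last `re` column is the right edge of the board, x = 2s, at distance `s` from the middle.
    last : ∀ m → s ≡ 2 * suc m → column (re m) ≡ s + s
    last m e = trans (re≡s+ m) (cong (s +_) (trans (*-comm (suc m) 2) (sym e)))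

  Next⇒Apart : ∀ {r r′ y y′} → Next r r′ → InRow r y → InRow r′ y′ → Apart 1 y y′
  Next⇒Apart (inc {up} {η}) refl refl = inj₁ (+-suc (suc s) η)
  Next⇒Apart (dec {up} {η}) refl refl = inj₂ (+-suc (suc s) η)
  Next⇒Apart {y′ = y′} (inc {down} {η}) ρ ρ′ =
    inj₂ (+-cancelˡ-≡ η _ _ (trans ρ (trans (sym ρ′) (sym (+-suc η y′)))))
  Next⇒Apart {y = y} (dec {down} {η}) ρ ρ′ =
    inj₁ (+-cancelˡ-≡ η _ _ (trans ρ′ (trans (sym ρ) (sym (+-suc η y)))))
  Next⇒Apart (over {up})   refl refl = inj₂ (cong suc (+-identityʳ s))
  Next⇒Apart (over {down}) refl refl = inj₁ (cong suc (+-identityʳ s))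

  Shift⇒Apart : ∀ {r r′ y y′} → Shift r r′ → InRow r y → InRow r′ y′ → Apart s y y′
  Shift⇒Apart {y′ = y′} (cross {up} {η} {η′} e) refl ρ′ = inj₂ (begin
      suc s + η            ≡⟨ cong (λ t → suc t + η) (sym ρ′) ⟩
      suc (η′ + y′) + η    ≡⟨ rearrange η η′ y′ ⟩
      suc (η + η′) + y′    ≡⟨ cong (_+ y′) e ⟩
      s + y′               ∎)
    where
    open ≡-Reasoning
    rearrange : ∀ a b c → suc (b + c) + a ≡ suc (a + b) + c
    rearrange = solve-∀
  Shift⇒Apart {y = y} (cross {down} {η} {η′} e) ρ refl = inj₁ (begin
      suc s + η′           ≡⟨ cong (λ t → suc t + η′) (sym ρ) ⟩
      suc (η + y) + η′     ≡⟨ rearrange η η′ y ⟩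
      suc (η + η′) + y     ≡⟨ cong (_+ y) e ⟩
      s + y                ∎)
    where
    open ≡-Reasoning
    rearrange : ∀ a b c → suc (a + c) + b ≡ suc (a + b) + c
    rearrange = solve-∀
  Shift⇒Apart (out {up}) refl refl =
    inj₁ (trans (+-comm (suc s) s) (cong (s +_) (sym (+-identityʳ (suc s)))))
  Shift⇒Apart (back {up}) refl refl =
    inj₂ (trans (+-comm (suc s) s) (cong (s +_) (sym (+-identityʳ (suc s)))))
  Shift⇒Apart {y′ = y′} (out {down})  refl ρ′ = inj₂ (sym ρ′)
  Shift⇒Apart {y = y}   (back {down}) ρ refl  = inj₁ (sym ρ)

  column-surjective : s ≡ 2 * k → ∀ {x} → x < 4 * k + 1 → ∃ λ c → OnBoard c × column c ≡ x
  column-surjective s≡2k {x} x< with <-cmp x s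
  ... | tri< x<s _ _ = left (halve x)
    where
    x<k*2 : x < k * 2
    x<k*2 = subst (x <_) (trans s≡2k (*-comm 2 k)) x<s
    left : (∃ λ m → x ≡ m * 2 ⊎ x ≡ 1 + m * 2) → ∃ λ c → OnBoard c × column c ≡ x
    left (m , inj₁ refl) = le m , le (*-cancelʳ-< 2 m k x<k*2) , refl
    left (m , inj₂ refl) = lo m , lo (*-cancelʳ-< 2 m k (<-trans (n<1+n _) x<k*2)) , refl
  ... | tri≈ _ refl _ = mid , mid , refl
  ... | tri> _ _ s<x = right (halve z)
    where
    z : ℕ
    z = x ∸ suc s
    x≡ : suc s + z ≡ x
    x≡ = m+[n∸m]≡n s<x
    total : ∀ k → 4 * k + 1 ≡ suc (2 * k) + k * 2
    total = solve-∀
    z< : z < k * 2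
    z< = +-cancelˡ-< (suc s) _ _
           (subst₂ _<_ (sym x≡) (trans (total k) (cong (λ t → suc t + k * 2) (sym s≡2k))) x<)
    right : (∃ λ m → z ≡ m * 2 ⊎ z ≡ 1 + m * 2) → ∃ λ c → OnBoard c × column c ≡ x
    right (m , inj₁ e) = ro m , ro (*-cancelʳ-< 2 m k (subst (_< k * 2) e z<)) ,
      trans (cong (suc s +_) (sym e)) x≡
    right (m , inj₂ e) = re m , re (*-cancelʳ-< 2 m k (<-trans (n<1+n _) (subst (_< k * 2) e z<))) ,
      trans (trans (sym (+-suc (suc s) _)) (cong (suc s +_) (sym e))) x≡

  row-surjective : s ≡ 2 * k → ∀ {y} → y < 4 * k + 2 → ∃ λ r → proj₂ r ≤ s × InRow r y
  row-surjective s≡2k {y} y< with y ≤? s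
  ... | yes y≤s = (down , s ∸ y) , m∸n≤m s y , m∸n+n≡m y≤s
  ... | no y≰s = (up , y ∸ suc s) , m≤n+o⇒m∸n≤o y (suc s) y≤ , sym (m+[n∸m]≡n (≰⇒> y≰s))
    where
    total : ∀ k → 4 * k + 2 ≡ suc (suc (2 * k) + 2 * k)
    total = solve-∀
    y≤ : y ≤ suc s + s
    y≤ = s≤s⁻¹ (subst (y <_) (trans (total k) (cong (λ t → suc (suc t + t)) (sym s≡2k))) y<)

-- From a half tour to a Hamiltonian cycle.

Apart⇒δ : ∀ {t a b} → b ≡ t + a ⊎ a ≡ t + b →
          ℤ.+ b ℤ.- ℤ.+ a ≡ ℤ.+ t ⊎ ℤ.+ b ℤ.- ℤ.+ a ≡ ℤ.- (ℤ.+ t)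
Apart⇒δ {t} {a} (inj₁ refl) = inj₁ (trans (ℤ.m-n≡m⊖n (t + a) a)
  (trans (ℤ.⊖-≥ (m≤n+m a t)) (cong ℤ.+_ (m+n∸n≡m t a))))
Apart⇒δ {t} {b = b} (inj₂ refl) = inj₂ (trans (ℤ.m-n≡m⊖n b (t + b))
  (trans (ℤ.⊖-swap b (t + b)) (cong ℤ.-_ (trans (ℤ.⊖-≥ (m≤n+m b t)) (cong ℤ.+_ (m+n∸n≡m t b))))))

halfTour⇒hamiltonian : ∀ {k s} → 1 ≤ k → s ≡ 2 * k → Leaper.HalfTour k s →
  LeaperHamiltonian 1 (2 * k) (4 * k + 1) (4 * k + 2)
halfTour⇒hamiltonian {k} {s} k≥1 s≡2k half =
  closedWalk⇒hamiltonian {R = Adj} {E = LeaperAdj 1 (2 * k) m n} φ φ-injective reflects pos steps meets N≥3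
  where
  open Leaper k s
  open HalfTour half
  m n : ℕ
  m = 4 * k + 1
  n = 4 * k + 2
  tour : Path start (mirror end)
  tour = path ++⟨ closes ⟩ mirrorPath path
  -- The mirror image of the edge `closes` ends at `mirror (mirror start)`, which is `start`.
  tour-closes : Adj (mirror end) start
  tour-closes = subst (Adj (mirror end)) (mirror-involutive start) (Adj-mirror closes)
  ∣tour∣ : ∣ tour ∣ ≡ m * n
  ∣tour∣ = trans (∣++∣ path (mirrorPath path))
    (trans (cong₂ _+_ size (trans (∣mirror∣ path) size)) (double k))
    where
    double : ∀ k → (4 * k + 1) * (2 * k + 1) + (4 * k + 1) * (2 * k + 1) ≡ (4 * k + 1) * (4 * k + 2)
    double = solve-∀
  pos : Fin (m * n) → Vertex
  pos i = at tour (toℕ i)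
  steps : ∀ i → Adj (pos i) (pos (next i))
  steps i with next-cases i
  ... | inj₁ (i< , eq) = subst (Adj (pos i) ∘ at tour) (sym eq)
          (at-step tour (toℕ i) (<-≤-trans i< (≤-reflexive (sym ∣tour∣))))
  ... | inj₂ (i≡ , eq) = subst₂ Adj (sym (at-last tour (toℕ i) (trans i≡ (sym ∣tour∣))))
          (trans (sym (at-zero tour)) (cong (at tour) (sym eq))) tour-closes
  tour-visits : ∀ {c} σ {η} → OnBoard c → η ≤ s → (c , σ , η) ∈ vertices tour
  tour-visits σ on η≤ with visitsAll on η≤
  ... | visit τ ∈p = subst (_ ∈_) (sym (vertices-++ path (mirrorPath path))) (side σ τ ∈p)
    where
    in-mirror : ∀ {v} → v ∈ vertices path → mirror v ∈ vertices (mirrorPath path)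
    in-mirror v∈ = subst (_ ∈_) (sym (vertices-mirror path)) (∈-map⁺ mirror v∈)
    -- If the path meets the orbit on the wrong side, the mirrored half meets it on the right one.
    side : ∀ σ τ {c η} → (c , τ , η) ∈ vertices path →
           (c , σ , η) ∈ vertices path ++ vertices (mirrorPath path)
    side up   up   ∈p = ∈-++⁺ˡ ∈p
    side down down ∈p = ∈-++⁺ˡ ∈p
    side up   down ∈p = ∈-++⁺ʳ (vertices path) (in-mirror ∈p)
    side down up   ∈p = ∈-++⁺ʳ (vertices path) (in-mirror ∈p)
  columnOf : (x : Fin m) → ∃ λ c → OnBoard c × column c ≡ toℕ x
  columnOf x = column-surjective s≡2k (Fin.toℕ<n x)
  rowOf : (y : Fin n) → ∃ λ r → proj₂ r ≤ s × InRow r (toℕ y)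
  rowOf y = row-surjective s≡2k (Fin.toℕ<n y)
  φ : Square m n → Vertex
  φ (x , y) = proj₁ (columnOf x) , proj₁ (rowOf y)
  φ-injective : Injective _≡_ _≡_ φ
  φ-injective {x , y} {x′ , y′} eq = cong₂ _,_
    (Fin.toℕ-injective (trans (sym (proj₂ (proj₂ (columnOf x))))
      (trans (cong column (,-injectiveˡ eq)) (proj₂ (proj₂ (columnOf x′))))))
    (Fin.toℕ-injective (InRow-unique (proj₂ (proj₂ (rowOf y)))
      (subst (λ r → InRow r (toℕ y′)) (sym (,-injectiveʳ eq)) (proj₂ (proj₂ (rowOf y′))))))
  meets : ∀ v → ∃ λ i → pos i ≡ φ v
  meets (x , y) with columnOf x | rowOf y
  ... | c , on , _ | (σ , η) , η≤ , _ with ∈⇒at tour (tour-visits σ on η≤)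
  ... | i , i< , eq = fromℕ< i<N , trans (cong (at tour) (Fin.toℕ-fromℕ< i<N)) eq
    where
    i<N : i < m * n
    i<N = <-≤-trans i< (≤-reflexive ∣tour∣)
  reflects : ∀ v w → Adj (φ v) (φ w) → LeaperAdj 1 (2 * k) m n v w
  reflects (x , y) (x′ , y′) adj with columnOf x | columnOf x′ | rowOf y | rowOf y′
  reflects _ _ (hor b h) | _ , _ , ex | _ , _ , ex′ | _ , _ , ρ | _ , _ , ρ′ =
    inj₁ ( Apart⇒δ (subst₂ (Apart 1) ex ex′ (Beside⇒Apart b))
         , Apart⇒δ (subst (λ t → Apart t _ _) s≡2k (Shift⇒Apart h ρ ρ′)))
  reflects _ _ (ver a h) | _ , _ , ex | _ , _ , ex′ | _ , _ , ρ | _ , _ , ρ′ =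
    inj₂ ( Apart⇒δ (subst (λ t → Apart t _ _) s≡2k (subst₂ (Apart s) ex ex′ (Across⇒Apart s≡2k a)))
         , Apart⇒δ (Next⇒Apart h ρ ρ′))
  N≥3 : 3 ≤ m * n
  N≥3 = ≤-trans 3≤m (m≤m*n m n ⦃ >-nonZero (≤-trans (s≤s z≤n) (m≤n+m 2 (4 * k))) ⦄)
    where
    3≤m : 3 ≤ m
    3≤m = ≤-trans (≤-trans (s≤s (s≤s (s≤s z≤n))) (*-monoʳ-≤ 4 k≥1)) (m≤m+n (4 * k) 1)

-- Serves both for the four levels that one winding of the spiral adds and for the four rows from 1
-- + d to s = 4 + d.
data Within4 (g : ℕ) : ℕ → Set where
  below : ∀ {a} → a ≤ g → Within4 g a
  plus1 : Within4 g (1 + g)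
  plus2 : Within4 g (2 + g)
  plus3 : Within4 g (3 + g)
  plus4 : Within4 g (4 + g)

within4 : ∀ {g a} → a ≤ 4 + g → Within4 g a
within4 a≤4+g with m≤n⇒m<n∨m≡n a≤4+g
... | inj₂ refl = plus4
... | inj₁ (s≤s a≤3+g) with m≤n⇒m<n∨m≡n a≤3+g
...   | inj₂ refl = plus3
...   | inj₁ (s≤s a≤2+g) with m≤n⇒m<n∨m≡n a≤2+g
...     | inj₂ refl = plus2
...     | inj₁ (s≤s a≤1+g) with m≤n⇒m<n∨m≡n a≤1+g
...       | inj₂ refl      = plus1
...       | inj₁ (s≤s a≤g) = below a≤g

-- The pieces of the spiral for `k` at least 2: crossings, turn and rim.

module Spiral (n d : ℕ) where

  -- With `d` a parameter of its own, rows near the rim are constructor terms such as `3 + d`; the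
  -- relation `d ≡ n + n` enters only in `core` and `halfTour`.
  k s : ℕ
  k = 2 + n
  s = 4 + d

  open Leaper k s

  private variable
    a b g m : ℕ
    c : Column
    η : ℕ

  -- With y = s + 1 + a, the crossing alternates between the rows y and y + 1 in the outer
  -- columns of the pairs and the rows y − s and y + 1 − s in the inner ones.
  crossingBlock : suc (a + suc b) ≡ s → ∀ m → Path (le m , up , a) (re m , up , suc a)
  crossingBlock {a} {b} e m =
    (le m , up , a)       ∷⟨ hor le-lo (cross e) ⟩
    (lo m , down , suc b) ∷⟨ ver lo-ro dec ⟩
    (ro m , down , b)     ∷⟨ hor ro-re (cross (trans (cong suc (trans (+-comm b (suc a)) (sym (+-suc a b)))) e)) ⟩
    [ re m , up , suc a ]

  crossing : suc (a + suc b) ≡ s → Path (le 0 , up , a) (re (1 + n) , up , suc a)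
  crossing e = chain (crossingBlock e) (λ _ → ver re-le dec) (1 + n)

  -- The crossings of levels 1 to s - 3 leave out sixteen orbits in the four columns with index `m`.
  -- The turn takes eight: row 0 of `le`, rows s - 1 and s of `lo`, s - 2 to s of `ro`, 0 and 1 of
  -- `re`.
  turnBlock : ∀ m → Path (le m , down , 0) (re m , down , 1)
  turnBlock m =
    (le m , down , 0)     ∷⟨ hor le-lo out ⟩
    (lo m , down , 4 + d) ∷⟨ ver lo-ro dec ⟩
    (ro m , down , 3 + d) ∷⟨ hor ro-re (cross (cong (4 +_) (+-identityʳ d))) ⟩
    (re m , up , 0)       ∷⟨ hor re-ro out ⟩
    (ro m , up , 4 + d)   ∷⟨ ver ro-lo dec ⟩
    (lo m , up , 3 + d)   ∷⟨ ver lo-ro dec ⟩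
    (ro m , up , 2 + d)   ∷⟨ hor ro-re (cross (cong (3 +_) (+-comm d 1))) ⟩
    [ re m , down , 1 ]

  turn : Path (le 0 , down , 0) (re (1 + n) , down , 1)
  turn = chain turnBlock (λ _ → ver re-le dec) (1 + n)

  -- Collects orbits left by the crossings and the turn. Since `re m` leads to `le (suc m)`, rows s
  -- - 1 and s of `le` and row 0 of `lo` are taken from the following pair; those of pair 0 are left
  -- for the opening of the half tour.
  rimBlock : ∀ m → Path (le m , down , 2 + d) (re m , down , 3 + d)
  rimBlock m =
    (le m , down , 2 + d)       ∷⟨ hor le-lo (cross (cong (3 +_) (+-comm d 1))) ⟩
    (lo m , up , 1)             ∷⟨ ver lo-ro dec ⟩
    (ro m , up , 0)             ∷⟨ hor ro-re out ⟩
    (re m , up , 4 + d)         ∷⟨ ver re-le dec ⟩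
    (le (suc m) , up , 3 + d)   ∷⟨ hor le-lo (cross (cong (4 +_) (+-identityʳ d))) ⟩
    (lo (suc m) , down , 0)     ∷⟨ hor lo-le out ⟩
    (le (suc m) , down , 4 + d) ∷⟨ ver le-re dec ⟩
    [ re m , down , 3 + d ]

  -- The last `re` column leads to the middle instead of a further `le`, so the block breaks off
  -- there.
  rimEnd : Path (le (1 + n) , down , 2 + d) (mid , up , 3 + d)
  rimEnd =
    (le (1 + n) , down , 2 + d) ∷⟨ hor le-lo (cross (cong (3 +_) (+-comm d 1))) ⟩
    (lo (1 + n) , up , 1)       ∷⟨ ver lo-ro dec ⟩
    (ro (1 + n) , up , 0)       ∷⟨ hor ro-re out ⟩
    (re (1 + n) , up , 4 + d)   ∷⟨ ver (re-mid refl) dec ⟩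
    [ mid , up , 3 + d ]

  rims : Path (le 0 , down , 2 + d) (re n , down , 3 + d)
  rims = chain rimBlock (λ _ → ver re-le dec) n

  rim : Path (le 0 , down , 2 + d) (mid , up , 3 + d)
  rim = rims ++⟨ ver re-le dec ⟩ rimEnd

  ∣crossing∣ : (e : suc (a + suc b) ≡ s) → ∣ crossing e ∣ ≡ k * 4
  ∣crossing∣ e = ∣chain∣ (crossingBlock e) _ (λ _ → refl) (1 + n)

  ∣turn∣ : ∣ turn ∣ ≡ k * 8
  ∣turn∣ = ∣chain∣ turnBlock _ (λ _ → refl) (1 + n)

  ∣rim∣ : ∣ rim ∣ ≡ suc n * 8 + 5
  ∣rim∣ = trans (∣++∣ rims rimEnd) (cong (_+ 5) (∣chain∣ rimBlock _ (λ _ → refl) n))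

  crossing-⊒ : (e : suc (a + suc b) ≡ s) → m < k → crossing e ⊒ crossingBlock e m
  crossing-⊒ e m<k = chain-⊒ (crossingBlock e) _ (s≤s⁻¹ m<k)

  turn-⊒ : m < k → turn ⊒ turnBlock m
  turn-⊒ m<k = chain-⊒ turnBlock _ (s≤s⁻¹ m<k)

  rim-⊒ : m ≤ n → rim ⊒ rimBlock m
  rim-⊒ m≤n = ⊒-++ˡ rims rimEnd ∘ chain-⊒ rimBlock _ m≤n

  rim-⊒-end : rim ⊒ rimEnd
  rim-⊒-end = ⊒-++ʳ rims rimEnd

  -- The level `a` determines `b`, and equality proofs in ℕ are unique. So covering one crossing of
  -- a level covers it for every choice of witness.
  crossing-unique : ∀ {b′} (e : suc (a + suc b) ≡ s) (e′ : suc (a + suc b′) ≡ s) →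
                    crossing e ⊒ crossing e′
  crossing-unique {a} e e′
    with suc-injective (+-cancelˡ-≡ (suc a) _ _ (trans e (sym e′)))
  ... | refl rewrite ≡-irrelevant e e′ = λ v → v

  -- Winding the spiral outwards.

  -- The inner part of the spiral, with all crossings of level at most g.
  record Core (g : ℕ) : Set where
    field
      path    : Path (mid , up , 2 + g) (mid , down , g)
      size    : ∣ path ∣ ≡ (2 + g) * (4 * k + 1)
      mids    : η ≤ g → Visits path mid η
      crosses : (e : suc (a + suc b) ≡ s) → 1 ≤ a → a ≤ g → path ⊒ crossing e
      turns   : path ⊒ turn

  -- The turn is run backwards and mirrored, so it is entered from the upper side; the axis is
  -- crossed after it, on the way to `mid`.
  core-0 : Core 0
  core-0 = record
    { path    = (mid , up , 2) ∷⟨ ver (mid-re refl) dec ⟩ rest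
    ; size    = trans (cong suc (trans (∣++∣ turn′ [ mid , down , 0 ])
                  (cong (_+ 1) (trans (∣mirror∣ (reversePath turn)) (trans (∣reverse∣ turn) ∣turn∣)))))
                  (count n)
    ; mids    = λ { z≤n → ⊒-∷ rest (⊒-++ʳ turn′ [ _ ] (visit down #0)) }
    ; crosses = λ e 1≤a a≤0 → contradiction (≤-trans 1≤a a≤0) λ ()
    ; turns   = ⊒-∷ rest ∘ ⊒-++ˡ turn′ [ _ ] ∘ ⊒-mirror (reversePath turn) ∘ ⊒-reverse turn
    }
    where
    turn′ : Path (re (1 + n) , up , 1) (le 0 , up , 0)
    turn′ = mirrorPath (reversePath turn)
    rest : Path (re (1 + n) , up , 1) (mid , down , 0)
    rest = turn′ ++⟨ ver le-mid over ⟩ [ mid , down , 0 ]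
    count : ∀ n → suc ((2 + n) * 8 + 1) ≡ 2 * (4 * (2 + n) + 1)
    count = solve-∀

  -- The centre for `d` congruent to 2 modulo 4. Levels 2 and 1 are crossed from right to left, the
  -- axis is crossed from `mid`, and the turn is then run forwards.
  core-2 : ∀ {r} → 2 + r ≡ d → Core 2
  core-2 {r} refl = record
    { path    = path′
    ; size    = trans (cong suc (trans (∣++∣ x₂ p₁) (cong₂ _+_ ∣x₂∣ (cong suc (trans (∣++∣ x₁ p₀)
                  (cong₂ _+_ ∣x₁∣ (cong suc (trans (∣++∣ turn [ _ ]) (cong (_+ 1) ∣turn∣)))))))))
                  (count n)
    ; mids    = λ
      { {0} _ → to-q₁ (⊒-++ʳ x₁ p₀ (visit up #0))
      ; {1} _ → to-p₁ (visit up #0)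
      ; {2} _ → to-q₀ (⊒-++ʳ turn [ _ ] (visit down #0))
      ; {suc (suc (suc _))} (s≤s (s≤s ())) }
    ; crosses = λ
      { {1} e _ _ → to-q₁ ∘ ⊒-++ˡ x₁ p₀ ∘ ⊒-reverse (crossing e₁) ∘ crossing-unique e₁ e
      ; {2} e _ _ → ⊒-∷ p₂ ∘ ⊒-++ˡ x₂ p₁ ∘ ⊒-reverse (crossing e₂) ∘ crossing-unique e₂ e
      ; {suc (suc (suc _))} _ _ (s≤s (s≤s ())) }
    ; turns   = to-q₀ ∘ ⊒-++ˡ turn [ _ ]
    }
    where
    e₁ : suc (1 + suc (3 + r)) ≡ s
    e₁ = refl
    e₂ : suc (2 + suc (2 + r)) ≡ s
    e₂ = refl
    x₁ = reversePath (crossing e₁)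
    x₂ = reversePath (crossing e₂)
    ∣x₁∣ : ∣ x₁ ∣ ≡ k * 4
    ∣x₁∣ = trans (∣reverse∣ (crossing e₁)) (∣crossing∣ e₁)
    ∣x₂∣ : ∣ x₂ ∣ ≡ k * 4
    ∣x₂∣ = trans (∣reverse∣ (crossing e₂)) (∣crossing∣ e₂)
    q₀ : Path (le 0 , down , 0) (mid , down , 2)
    q₀ = turn ++⟨ ver (re-mid refl) inc ⟩ [ mid , down , 2 ]
    p₀ : Path (mid , up , 0) (mid , down , 2)
    p₀ = (mid , up , 0) ∷⟨ ver mid-le over ⟩ q₀
    q₁ : Path (re (1 + n) , up , 2) (mid , down , 2)
    q₁ = x₁ ++⟨ ver le-mid dec ⟩ p₀
    p₁ : Path (mid , up , 1) (mid , down , 2)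
    p₁ = (mid , up , 1) ∷⟨ ver (mid-re refl) inc ⟩ q₁
    p₂ : Path (re (1 + n) , up , 3) (mid , down , 2)
    p₂ = x₂ ++⟨ ver le-mid dec ⟩ p₁
    path′ : Path (mid , up , 4) (mid , down , 2)
    path′ = (mid , up , 4) ∷⟨ ver (mid-re refl) dec ⟩ p₂
    to-p₁ : path′ ⊒ p₁
    to-p₁ = ⊒-∷ p₂ ∘ ⊒-++ʳ x₂ p₁
    to-q₁ : path′ ⊒ q₁
    to-q₁ = to-p₁ ∘ ⊒-∷ q₁
    to-q₀ : path′ ⊒ q₀
    to-q₀ = to-q₁ ∘ ⊒-++ʳ x₁ p₀ ∘ ⊒-∷ q₀
    count : ∀ n → suc ((2 + n) * 4 + suc ((2 + n) * 4 + suc ((2 + n) * 8 + 1))) ≡ 4 * (4 * (2 + n) + 1)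
    count = solve-∀

  -- Levels 4 + g and 3 + g are crossed from right to left before the old core, and 1 + g and 2 + g,
  -- mirrored, from left to right after it. The middle column gains rows 6 + g, 3 + g, 1 + g and 4 +
  -- g, which restores the gap at 5 + g.
  core-step : ∀ {r} → 4 + g + r ≡ d → Core g → Core (4 + g)
  core-step {g} {r} refl core = record
    { path    = path′
    ; size    = trans (cong suc
                  (trans (∣++∣ x₄ p₄) (cong₂ _+_ ∣x₄∣ (cong suc
                  (trans (∣++∣ x₃ q₃) (cong₂ _+_ ∣x₃∣
                  (trans (∣++∣ path q₂) (cong₂ _+_ size
                  (trans (∣++∣ x₁ p₁) (cong₂ _+_ ∣x₁∣ (cong suc
                  (trans (∣++∣ x₂ [ _ ]) (cong (_+ 1) ∣x₂∣))))))))))))) (count n g)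
    ; mids    = mids′ ∘ within4
    ; crosses = λ e 1≤a → crosses′ e 1≤a ∘ within4
    ; turns   = to-core ∘ turns
    }
    where
    open Core core
    e₁ : suc (1 + g + suc (5 + r)) ≡ s
    e₁ = eq g r where
      eq : ∀ g r → suc (1 + g + suc (5 + r)) ≡ 8 + (g + r)
      eq = solve-∀
    e₂ : suc (2 + g + suc (4 + r)) ≡ s
    e₂ = eq g r where
      eq : ∀ g r → suc (2 + g + suc (4 + r)) ≡ 8 + (g + r)
      eq = solve-∀
    e₃ : suc (3 + g + suc (3 + r)) ≡ s
    e₃ = eq g r where
      eq : ∀ g r → suc (3 + g + suc (3 + r)) ≡ 8 + (g + r)
      eq = solve-∀
    e₄ : suc (4 + g + suc (2 + r)) ≡ s
    e₄ = eq g r where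
      eq : ∀ g r → suc (4 + g + suc (2 + r)) ≡ 8 + (g + r)
      eq = solve-∀
    x₁ = mirrorPath (crossing e₁)
    x₂ = mirrorPath (crossing e₂)
    x₃ = reversePath (crossing e₃)
    x₄ = reversePath (crossing e₄)
    ∣x₁∣ : ∣ x₁ ∣ ≡ k * 4
    ∣x₁∣ = trans (∣mirror∣ (crossing e₁)) (∣crossing∣ e₁)
    ∣x₂∣ : ∣ x₂ ∣ ≡ k * 4
    ∣x₂∣ = trans (∣mirror∣ (crossing e₂)) (∣crossing∣ e₂)
    ∣x₃∣ : ∣ x₃ ∣ ≡ k * 4
    ∣x₃∣ = trans (∣reverse∣ (crossing e₃)) (∣crossing∣ e₃)
    ∣x₄∣ : ∣ x₄ ∣ ≡ k * 4
    ∣x₄∣ = trans (∣reverse∣ (crossing e₄)) (∣crossing∣ e₄)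
    q₁ : Path (le 0 , down , 2 + g) (mid , down , 4 + g)
    q₁ = x₂ ++⟨ ver (re-mid refl) inc ⟩ [ mid , down , 4 + g ]
    p₁ : Path (mid , down , 1 + g) (mid , down , 4 + g)
    p₁ = (mid , down , 1 + g) ∷⟨ ver mid-le inc ⟩ q₁
    q₂ : Path (le 0 , down , 1 + g) (mid , down , 4 + g)
    q₂ = x₁ ++⟨ ver (re-mid refl) dec ⟩ p₁
    q₃ : Path (mid , up , 2 + g) (mid , down , 4 + g)
    q₃ = path ++⟨ ver mid-le inc ⟩ q₂
    q₄ : Path (re (1 + n) , up , 4 + g) (mid , down , 4 + g)
    q₄ = x₃ ++⟨ ver le-mid dec ⟩ q₃
    p₄ : Path (mid , up , 3 + g) (mid , down , 4 + g)
    p₄ = (mid , up , 3 + g) ∷⟨ ver (mid-re refl) inc ⟩ q₄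
    q₅ : Path (re (1 + n) , up , 5 + g) (mid , down , 4 + g)
    q₅ = x₄ ++⟨ ver le-mid dec ⟩ p₄
    path′ : Path (mid , up , 6 + g) (mid , down , 4 + g)
    path′ = (mid , up , 6 + g) ∷⟨ ver (mid-re refl) dec ⟩ q₅
    to-p₄ : path′ ⊒ p₄
    to-p₄ = ⊒-∷ q₅ ∘ ⊒-++ʳ x₄ p₄
    to-q₃ : path′ ⊒ q₃
    to-q₃ = to-p₄ ∘ ⊒-∷ q₄ ∘ ⊒-++ʳ x₃ q₃
    to-core : path′ ⊒ path
    to-core = to-q₃ ∘ ⊒-++ˡ path q₂
    to-q₂ : path′ ⊒ q₂
    to-q₂ = to-q₃ ∘ ⊒-++ʳ path q₂
    to-p₁ : path′ ⊒ p₁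
    to-p₁ = to-q₂ ∘ ⊒-++ʳ x₁ p₁
    to-q₁ : path′ ⊒ q₁
    to-q₁ = to-p₁ ∘ ⊒-∷ q₁
    mids′ : Within4 g η → Visits path′ mid η
    mids′ (below η≤g) = to-core (mids η≤g)
    mids′ plus1       = to-p₁ (visit down #0)
    -- Row 2 + g of the middle column is where the old core begins.
    mids′ plus2       = to-q₃ (visits-start q₃)
    mids′ plus3       = to-p₄ (visit up #0)
    mids′ plus4       = to-q₁ (⊒-++ʳ x₂ [ _ ] (visit down #0))
    crosses′ : (e : suc (a + suc b) ≡ s) → 1 ≤ a → Within4 g a → path′ ⊒ crossing e
    crosses′ e 1≤a (below a≤g) = to-core ∘ crosses e 1≤a a≤g
    crosses′ e _   plus1 = to-q₂ ∘ ⊒-++ˡ x₁ p₁ ∘ ⊒-mirror (crossing e₁) ∘ crossing-unique e₁ e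
    crosses′ e _   plus2 = to-q₁ ∘ ⊒-++ˡ x₂ [ _ ] ∘ ⊒-mirror (crossing e₂) ∘ crossing-unique e₂ e
    crosses′ e _   plus3 = to-p₄ ∘ ⊒-∷ q₄ ∘ ⊒-++ˡ x₃ q₃ ∘ ⊒-reverse (crossing e₃) ∘ crossing-unique e₃ e
    crosses′ e _   plus4 = ⊒-∷ q₅ ∘ ⊒-++ˡ x₄ p₄ ∘ ⊒-reverse (crossing e₄) ∘ crossing-unique e₄ e
    count : ∀ n g → suc ((2 + n) * 4 + suc ((2 + n) * 4 + ((2 + g) * (4 * (2 + n) + 1) +
              ((2 + n) * 4 + suc ((2 + n) * 4 + 1))))) ≡ (6 + g) * (4 * (2 + n) + 1)
    count = solve-∀

  -- Here `d` is fixed and `r` is the room left outside the core; it grows by four at each recursive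
  -- call.
  multiple-core : ∀ t {r} → t * 4 + r ≡ d → Core (t * 4)
  multiple-core zero    _ = core-0
  multiple-core (suc t) {r} e = core-step e (multiple-core t (trans (rearrange t r) e))
    where
    rearrange : ∀ t r → t * 4 + (4 + r) ≡ 4 + t * 4 + r
    rearrange = solve-∀

  multiple-core+2 : ∀ t {r} → 2 + t * 4 + r ≡ d → Core (2 + t * 4)
  multiple-core+2 zero    e = core-2 e
  multiple-core+2 (suc t) {r} e = core-step e (multiple-core+2 t (trans (rearrange t r) e))
    where
    rearrange : ∀ t r → 2 + t * 4 + (4 + r) ≡ 6 + t * 4 + r
    rearrange = solve-∀

  -- The parity of `n` decides whether `d` is 0 or 2 modulo 4. A winding adds four levels, so this
  -- selects the centre, `core-0` or `core-2`.
  core : d ≡ n + n → Core d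
  core d≡n+n with halve n
  ... | t , inj₁ refl = subst Core (sym d≡4t) (multiple-core t (trans (+-identityʳ _) (sym d≡4t)))
    where
    quadruple : ∀ t → t * 2 + t * 2 ≡ t * 4
    quadruple = solve-∀
    d≡4t : d ≡ t * 4
    d≡4t = trans d≡n+n (quadruple t)
  ... | t , inj₂ refl = subst Core (sym d≡4t+2) (multiple-core+2 t (trans (+-identityʳ _) (sym d≡4t+2)))
    where
    quadruple : ∀ t → 1 + t * 2 + (1 + t * 2) ≡ 2 + t * 4
    quadruple = solve-∀
    d≡4t+2 : d ≡ 2 + t * 4
    d≡4t+2 = trans d≡n+n (quadruple t)

  -- Assembling the half tour.

  data Level : ℕ → Set where
    lowest : Level 0
    -- The equation is symmetric because row η of `le` lies on the crossing of level η, but row η of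
    -- `ro` on that of level s - 2 - η.
    inner  : suc a + suc b ≡ 2 + d → Level (suc a)
    s-2    : Level (2 + d)
    s-1    : Level (3 + d)
    s-0    : Level (4 + d)

  level : η ≤ 4 + d → Level η
  level {zero}  _ = lowest
  level {suc a} 1+a≤4+d with within4 1+a≤4+d
  ... | below 1+a≤d = inner {b = 1 + d ∸ suc a} (trans (+-suc (suc a) _) (cong suc (m+[n∸m]≡n (m≤n⇒m≤1+n 1+a≤d))))
  ... | plus1       = inner {b = 0} (+-comm (1 + d) 1)
  ... | plus2       = s-2
  ... | plus3       = s-1
  ... | plus4       = s-0

  data Pair : ℕ → Set where
    early : m ≤ n → Pair m
    last  : Pair (1 + n)

  pair : m < k → Pair m
  pair (s≤s m≤1+n) with m≤n⇒m<n∨m≡n m≤1+n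
  ... | inj₁ (s≤s m≤n) = early m≤n
  ... | inj₂ refl      = last

  halfTour : d ≡ n + n → HalfTour
  halfTour d≡n+n = record
    { path      = path′
    ; closes    = ver mid-le inc
    ; size      = trans (cong (5 +_) (trans (∣++∣ path q₁) (cong₂ _+_ size
                    (trans (∣++∣ x p) (cong₂ _+_ ∣x∣ (cong suc ∣rim∣))))))
                    (trans (cong (λ t → 5 + ((2 + t) * (4 * k + 1) + (k * 4 + suc (suc n * 8 + 5)))) d≡n+n)
                      (count n))
    ; visitsAll = visitsAll
    }
    where
    open Core (core d≡n+n)
    -- The outermost crossing, of level 1 + d = s - 3, is added outside the core and leads to the
    -- rim.
    e : suc (1 + d + 2) ≡ s
    e = cong (2 +_) (+-comm d 2)
    x = mirrorPath (crossing e)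
    ∣x∣ : ∣ x ∣ ≡ k * 4
    ∣x∣ = trans (∣mirror∣ (crossing e)) (∣crossing∣ e)
    p : Path (mid , down , 1 + d) (mid , up , 3 + d)
    p = (mid , down , 1 + d) ∷⟨ ver mid-le inc ⟩ rim
    q₁ : Path (le 0 , down , 1 + d) (mid , up , 3 + d)
    q₁ = x ++⟨ ver (re-mid refl) dec ⟩ p
    q₂ : Path (mid , up , 2 + d) (mid , up , 3 + d)
    q₂ = path ++⟨ ver mid-le inc ⟩ q₁
    -- The first five vertices represent the orbits that all other pieces miss: three in pair 0, row
    -- `s` of `mid`, and row s - 1 of the last `re` column.
    path′ : Path (le 0 , down , 4 + d) (mid , up , 3 + d)
    path′ =
      (le 0 , down , 4 + d)     ∷⟨ hor le-lo back ⟩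
      (lo 0 , down , 0)         ∷⟨ hor lo-le (cross refl) ⟩
      (le 0 , up , 3 + d)       ∷⟨ ver le-mid inc ⟩
      (mid , up , 4 + d)        ∷⟨ ver (mid-re refl) dec ⟩
      (re (1 + n) , up , 3 + d) ∷⟨ ver (re-mid refl) dec ⟩
      q₂
    to-q₂ : path′ ⊒ q₂
    to-q₂ (visit σ ∈q) = visit σ (there (there (there (there (there ∈q)))))
    to-path : path′ ⊒ path
    to-path = to-q₂ ∘ ⊒-++ˡ path q₁
    to-q₁ : path′ ⊒ q₁
    to-q₁ = to-q₂ ∘ ⊒-++ʳ path q₁
    to-p : path′ ⊒ p
    to-p = to-q₁ ∘ ⊒-++ʳ x p
    to-rim : m ≤ n → path′ ⊒ rimBlock m
    to-rim m≤n = to-p ∘ ⊒-∷ rim ∘ rim-⊒ m≤n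
    to-rimEnd : path′ ⊒ rimEnd
    to-rimEnd = to-p ∘ ⊒-∷ rim ∘ rim-⊒-end
    to-turn : m < k → path′ ⊒ turnBlock m
    to-turn m<k = to-path ∘ turns ∘ turn-⊒ m<k
    to-crossing : (e : suc (suc a + suc (suc b)) ≡ s) → path′ ⊒ crossing e
    to-crossing {a} {b} e′ = cases (m≤n⇒m<n∨m≡n 1+a≤1+d)
      where
      1+a≤1+d : suc a ≤ 1 + d
      1+a≤1+d = m+n≤o⇒m≤o (suc a) (≤-reflexive (+-cancelˡ-≡ 3 _ _ (trans (rearrange a b) e′)))
        where
        rearrange : ∀ a b → 3 + (suc a + b) ≡ suc (suc a + suc (suc b))
        rearrange = solve-∀
      cases : suc a < 1 + d ⊎ suc a ≡ 1 + d → path′ ⊒ crossing e′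
      cases (inj₁ (s≤s 1+a≤d)) = to-path ∘ crosses e′ (s≤s z≤n) 1+a≤d
      cases (inj₂ refl)        = to-q₁ ∘ ⊒-++ˡ x p ∘ ⊒-mirror (crossing e) ∘ crossing-unique e e′
    to-block : (e : suc (suc a + suc (suc b)) ≡ s) → m < k → path′ ⊒ crossingBlock e m
    to-block e m<k = to-crossing e ∘ crossing-⊒ e m<k
    rising : suc a + suc b ≡ 2 + d → suc (suc a + suc (suc b)) ≡ s
    rising {a} {b} eq = cong suc (trans (+-suc (suc a) (suc b)) (cong suc eq))
    falling : suc a + suc b ≡ 2 + d → suc (suc b + suc (suc a)) ≡ s
    falling {a} {b} eq = rising {b} {a} (trans (+-comm (suc b) (suc a)) eq)
    visits-le : ∀ {m} → m < k → Pair m → Level η → Visits path′ (le m) η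
    visits-le m<k _ lowest               = to-turn m<k (visit down #0)
    visits-le m<k _ (inner eq)           = to-block (rising eq) m<k (visit up #0)
    visits-le _ (early m≤n) s-2          = to-rim m≤n (visit down #0)
    visits-le _ last s-2                 = to-rimEnd (visit down #0)
    visits-le {m = zero} _ _ s-1         = visit up #2
    visits-le {m = suc m} m<k _ s-1      = to-rim (s≤s⁻¹ (s≤s⁻¹ m<k)) (visit up #4)
    visits-le {m = zero} _ _ s-0         = visit down #0
    visits-le {m = suc m} m<k _ s-0      = to-rim (s≤s⁻¹ (s≤s⁻¹ m<k)) (visit down #6)
    -- A crossing meets `lo` one row further out than `ro`, and `re` one further out than `le`.
    -- Hence `lo` and `re` are treated at `suc η`, their row 0 separately, and level `s` cannot
    -- occur.
    visits-lo : ∀ {m} → m < k → Pair m → η ≤ 3 + d → Level η → Visits path′ (lo m) (suc η)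
    visits-lo _ (early m≤n) _ lowest     = to-rim m≤n (visit up #1)
    visits-lo _ last _ lowest            = to-rimEnd (visit up #1)
    visits-lo m<k _ _ (inner eq)         = to-block (falling eq) m<k (visit down #1)
    visits-lo m<k _ _ s-2                = to-turn m<k (visit up #5)
    visits-lo m<k _ _ s-1                = to-turn m<k (visit down #1)
    visits-lo _ _ 4+d≤3+d s-0            = contradiction 4+d≤3+d 1+n≰n
    visits-ro : ∀ {m} → m < k → Pair m → Level η → Visits path′ (ro m) η
    visits-ro _ (early m≤n) lowest       = to-rim m≤n (visit up #2)
    visits-ro _ last lowest              = to-rimEnd (visit up #2)
    visits-ro m<k _ (inner eq)           = to-block (falling eq) m<k (visit down #2)
    visits-ro m<k _ s-2                  = to-turn m<k (visit up #6)
    visits-ro m<k _ s-1                  = to-turn m<k (visit down #2)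
    visits-ro m<k _ s-0                  = to-turn m<k (visit up #4)
    visits-re : ∀ {m} → m < k → Pair m → η ≤ 3 + d → Level η → Visits path′ (re m) (suc η)
    visits-re m<k _ _ lowest             = to-turn m<k (visit down #7)
    visits-re m<k _ _ (inner eq)         = to-block (rising eq) m<k (visit up #3)
    visits-re _ (early m≤n) _ s-2        = to-rim m≤n (visit down #7)
    visits-re _ last _ s-2               = visit up #4
    visits-re _ (early m≤n) _ s-1        = to-rim m≤n (visit up #3)
    visits-re _ last _ s-1               = to-rimEnd (visit up #3)
    visits-re _ _ 4+d≤3+d s-0            = contradiction 4+d≤3+d 1+n≰n
    visits-mid : Within4 d η → Visits path′ mid η
    visits-mid (below η≤d)               = to-path (mids η≤d)
    visits-mid plus1                     = to-p (visit down #0)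
    visits-mid plus2                     = to-q₂ (visits-start q₂)
    visits-mid plus3                     = to-rimEnd (visit up #4)
    visits-mid plus4                     = visit up #3
    visitsAll : OnBoard c → η ≤ s → Visits path′ c η
    visitsAll (le m<k) η≤s               = visits-le m<k (pair m<k) (level η≤s)
    visitsAll {η = zero} (lo {zero} _) _ = visit down #1
    visitsAll {η = zero} (lo {suc m} m<k) _ =
      to-rim (s≤s⁻¹ (s≤s⁻¹ m<k)) (visit down #5)
    visitsAll {η = suc η} (lo m<k) η<s   = visits-lo m<k (pair m<k) (s≤s⁻¹ η<s) (level (<⇒≤ η<s))
    visitsAll (ro m<k) η≤s               = visits-ro m<k (pair m<k) (level η≤s)
    visitsAll {η = zero} (re m<k) _      = to-turn m<k (visit up #3)
    visitsAll {η = suc η} (re m<k) η<s   = visits-re m<k (pair m<k) (s≤s⁻¹ η<s) (level (<⇒≤ η<s))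
    visitsAll mid η≤s                    = visits-mid (within4 η≤s)
    count : ∀ n → 5 + ((2 + (n + n)) * (4 * (2 + n) + 1) + ((2 + n) * 4 + suc (suc n * 8 + 5))) ≡
                  (4 * (2 + n) + 1) * (2 * (2 + n) + 1)
    count = solve-∀

-- The knight, `k = 1`.

knightHalfTour : Leaper.HalfTour 1 2
knightHalfTour = record
  -- Here s = 2 is too small for `Spiral`, but its pieces survive: the five opening vertices, `mid`,
  -- the first seven vertices of `turnBlock`, and the last three of `rimEnd`. As s - 2 = 0, the last
  -- two pieces share the vertex `(ro 0 , up , 0)`.
  { path =
      (le 0 , down , 2) ∷⟨ hor le-lo back ⟩
      (lo 0 , down , 0) ∷⟨ hor lo-le (cross refl) ⟩
      (le 0 , up , 1)   ∷⟨ ver le-mid inc ⟩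
      (mid , up , 2)    ∷⟨ ver (mid-re refl) dec ⟩
      (re 0 , up , 1)   ∷⟨ ver (re-mid refl) dec ⟩
      (mid , up , 0)    ∷⟨ ver mid-le over ⟩
      (le 0 , down , 0) ∷⟨ hor le-lo out ⟩
      (lo 0 , down , 2) ∷⟨ ver lo-ro dec ⟩
      (ro 0 , down , 1) ∷⟨ hor ro-re (cross refl) ⟩
      (re 0 , up , 0)   ∷⟨ hor re-ro out ⟩
      (ro 0 , up , 2)   ∷⟨ ver ro-lo dec ⟩
      (lo 0 , up , 1)   ∷⟨ ver lo-ro dec ⟩
      (ro 0 , up , 0)   ∷⟨ hor ro-re out ⟩
      (re 0 , up , 2)   ∷⟨ ver (re-mid refl) dec ⟩
      [ mid , up , 1 ]
  ; closes    = ver mid-le inc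
  ; size      = refl
  ; visitsAll = λ
      { (le (s≤s z≤n)) z≤n → visit down #6
      ; (le (s≤s z≤n)) (s≤s z≤n) → visit up #2
      ; (le (s≤s z≤n)) (s≤s (s≤s z≤n)) → visit down #0
      ; (lo (s≤s z≤n)) z≤n → visit down #1
      ; (lo (s≤s z≤n)) (s≤s z≤n) → visit up #11
      ; (lo (s≤s z≤n)) (s≤s (s≤s z≤n)) → visit down #7
      ; mid z≤n → visit up #5
      ; mid (s≤s z≤n) → visit up #14
      ; mid (s≤s (s≤s z≤n)) → visit up #3
      ; (ro (s≤s z≤n)) z≤n → visit up #12
      ; (ro (s≤s z≤n)) (s≤s z≤n) → visit down #8
      ; (ro (s≤s z≤n)) (s≤s (s≤s z≤n)) → visit up #10
      ; (re (s≤s z≤n)) z≤n → visit up #9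
      ; (re (s≤s z≤n)) (s≤s z≤n) → visit up #4
      ; (re (s≤s z≤n)) (s≤s (s≤s z≤n)) → visit up #13
      }
  }
  where
  open Leaper 1 2

theorem6 : (k : ℕ) → 1 ≤ k →
    LeaperHamiltonian 1 (2 * k) (4 * k + 1) (4 * k + 2)
theorem6 (suc zero)    k≥1 = halfTour⇒hamiltonian k≥1 refl knightHalfTour
theorem6 (suc (suc n)) k≥1 = halfTour⇒hamiltonian k≥1 (double n) (Spiral.halfTour n (n + n) refl)
  where
  double : ∀ n → 4 + (n + n) ≡ 2 * (2 + n)
  double = solve-∀
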